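{- Let $T$ be a propositional theory over $\mathcal V$, let $(\mathcal A,\oplus,\otimes,e^\oplus,e^\otimes)$ be a commutative semiring whose addition $\oplus$ is idempotent (i.e. $a\oplus a=a$ for all $a\in\mathcal A$), and let $\alpha:\mathcal L\to\mathcal A$ be a labeling function on the literals of $\mathcal V$. If $N_T$ is an s-DNNF representation of $T$ (i.e. an NNF circuit that is smooth and decomposable, is logically equivalent to $T$, and whose set of variables is $\mathcal V$), then evaluating $N_T$ is a sound AMC computation, i.e. $$\mathrm{Eval}(N_T,\oplus,\otimes,e^\oplus,e^\otimes,\alpha)=\mathbf A(T).$$
   Context: A semiring $(\mathcal A,\oplus,\otimes,e^\oplus,e^\otimes)$ has associative binary operations $\oplus,\otimes$ on $\mathcal A$, with $\oplus$ commutative, $\otimes$ distributing over $\oplus$, $e^\oplus$ neutral for $\oplus$, $e^\otimes$ neutral for $\otimes$, and $e^\oplus\otimes a=a\otimes e^\oplus=e^\oplus$ for all $a$. It is commutative if $\otimes$ is also commutative. Algebraic model count: for a propositional theory $T$ over a finite set $\mathcal V$ of variables and $\alpha:\mathcal L\to\mathcal A$ on the set $\mathcal L$ of literals of $\mathcal V$, $$\mathbf A(T)=\bigoplus_{I\in\mathcal M(T)}\ \bigotimes_{l\in I}\alpha(l),$$ where $\mathcal M(T)$ is the set of models of $T$; a model is a set of literals containing exactly one of $v,\neg v$ for each $v\in\mathcal V$. Empty sums are $e^\oplus$, empty products $e^\otimes$. An NNF circuit over $\mathcal V$ is a finite rooted directed acyclic graph whose leaves are labeled with $\top$, $\bot$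 or a literal of a variable in $\mathcal V$, and whose internal nodes are labeled $\vee$ or $\wedge$. Each node is identified with the formula of the subcircuit rooted at it, and its variables are those occurring in that subcircuit. The circuit is decomposable if for each conjunction node $\bigwedge_{i=1}^n\phi_i$ no two children $\phi_i,\phi_j$ ($i\ne j$) share a variable; smooth if for each disjunction node $\bigvee_{i=1}^n\phi_i$ all children mention the same set of variables. $\mathrm{Eval}$ is defined recursively from the leaves to the root: $\top\mapsto e^\otimes$, $\bot\mapsto e^\oplus$, literal $l\mapsto\alpha(l)$, a disjunction node $\mapsto$ the $\oplus$-sum of the values of its children, a conjunction node $\mapsto$ the $\otimes$-product of the values of its children; the value of the circuit is that of its root. -}

module Defs where

open import Algebra.Core using (Op₂)
open import Data.Bool.Base using (Bool; true; false; not; _∧_; _∨_)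
import Data.Bool.Properties as Bool
open import Data.Fin.Base using (Fin)
open import Data.Fin.Induction using (spo-noetherian)
open import Data.List.Base using (List; []; _∷_; map; foldr; filter; cartesianProductWith)
open import Data.List.Membership.Propositional using (_∈_; mapWith∈)
open import Data.List.NonEmpty.Base using (List⁺; toList)
open import Data.List.Relation.Unary.All using (All; all?)
open import Data.List.Relation.Unary.AllPairs using (AllPairs)
open import Data.Nat.Base using (ℕ; zero; suc)
open import Data.Product.Base using (∃; _×_; _,_)
open import Data.Sum.Base using (_⊎_)
import Data.Vec.Base as Vec
open import Data.Vec.Base using (Vec; lookup)
open import Function.Base using (flip)
open import Function.Bundles using (_⇔_)
open import Induction.WellFounded using (WellFounded; Acc; acc; module Subrelation)
open import Level using (Level; 0ℓ)
open import Relation.Binary.Construct.Closure.ReflexiveTransitive using (Star)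
open import Relation.Binary.Construct.Closure.Transitive as Plus using (TransClosure)
open import Relation.Binary.Core using (Rel)
open import Relation.Binary.PropositionalEquality
  using (_≡_; refl; isEquivalence)
open import Relation.Nullary.Decidable using (Dec)
open import Relation.Nullary.Negation using (¬_)
open import Relation.Unary using (Pred; Universal; _≐_; _≬_)

private
  variable
    a : Level
    m : ℕ

-- The variable set 𝒱 is Fin m throughout.

data Literal (m : ℕ) : Set where
  pos neg : Fin m → Literal m

-- A set of literals containing exactly one of v, ¬v for each v is encoded by
-- its sign vector; `literals` recovers the set.
Interpretation : ℕ → Set
Interpretation m = Vec Bool m

literalOf : Fin m → Bool → Literal m
literalOf v true  = pos v
literalOf v false = neg v

literals : Interpretation m → List (Literal m)
literals I = Vec.toList (Vec.tabulate (λ v → literalOf v (lookup I v)))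

interpretations : ∀ m → List (Interpretation m)
interpretations zero    = Vec.[] ∷ []
interpretations (suc m) =
  cartesianProductWith Vec._∷_ (true ∷ false ∷ []) (interpretations m)

infix  8 ¬′_
infixr 7 _∧′_
infixr 6 _∨′_
infixr 5 _⇒′_ _⇔′_

data Formula (m : ℕ) : Set where
  ⊤′ ⊥′                   : Formula m
  var                     : Fin m → Formula m
  ¬′_                     : Formula m → Formula m
  _∧′_ _∨′_ _⇒′_ _⇔′_     : Formula m → Formula m → Formula m

⟦_⟧ : Formula m → Interpretation m → Bool
⟦ ⊤′ ⟧     I = true
⟦ ⊥′ ⟧     I = false
⟦ var v ⟧  I = lookup I v
⟦ ¬′ φ ⟧   I = not (⟦ φ ⟧ I)
⟦ φ ∧′ ψ ⟧ I = ⟦ φ ⟧ I ∧ ⟦ ψ ⟧ I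
⟦ φ ∨′ ψ ⟧ I = ⟦ φ ⟧ I ∨ ⟦ ψ ⟧ I
⟦ φ ⇒′ ψ ⟧ I = not (⟦ φ ⟧ I) ∨ ⟦ ψ ⟧ I
⟦ φ ⇔′ ψ ⟧ I = (not (⟦ φ ⟧ I) ∨ ⟦ ψ ⟧ I) ∧ (not (⟦ ψ ⟧ I) ∨ ⟦ φ ⟧ I)

Theory : ℕ → Set
Theory m = List (Formula m)

literalFormula : Literal m → Formula m
literalFormula (pos v) = var v
literalFormula (neg v) = ¬′ var v

infix 4 _⊨_ _⊨?_

_⊨_ : Interpretation m → Theory m → Set
I ⊨ T = All (λ φ → ⟦ φ ⟧ I ≡ true) T

_⊨?_ : (I : Interpretation m) (T : Theory m) → Dec (I ⊨ T)
I ⊨? T = all? (λ φ → ⟦ φ ⟧ I Bool.≟ true) T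

models : Theory m → List (Interpretation m)
models {m} T = filter (_⊨? T) (interpretations m)

AMC : {A : Set a} (_⊕_ _⊗_ : Op₂ A) (e⊕ e⊗ : A) →
      (Literal m → A) → Theory m → A
AMC _⊕_ _⊗_ e⊕ e⊗ α T =
  foldr _⊕_ e⊕ (map (λ I → foldr _⊗_ e⊗ (map α (literals I))) (models T))

-- Node labels together with the outgoing edges, in a graph with nodes Fin n.
-- Internal nodes have at least one child; repeated edges are allowed.
data Node (m n : ℕ) : Set where
  ⊤ₙ ⊥ₙ   : Node m n
  lit     : Literal m → Node m n
  ⋁ₙ ⋀ₙ   : List⁺ (Fin n) → Node m n

children : ∀ {n} → Node m n → List (Fin n)
children ⊤ₙ      = []
children ⊥ₙ      = []
children (lit _) = []
children (⋁ₙ cs) = toList cs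
children (⋀ₙ cs) = toList cs

record NNF (m : ℕ) : Set where
  field
    size  : ℕ
    node  : Fin size → Node m size
    root  : Fin size

  infix 4 _⟶_
  _⟶_ : Rel (Fin size) 0ℓ
  i ⟶ j = j ∈ children (node i)

  field
    acyclic : ∀ i → ¬ TransClosure _⟶_ i i
    rooted  : ∀ i → Star _⟶_ root i

  children-wellFounded : WellFounded (flip _⟶_)
  children-wellFounded =
    Subrelation.wellFounded {_<₂_ = flip (TransClosure _⟶_)} Plus.[_]
      (spo-noetherian record
        { isEquivalence = isEquivalence
        ; irrefl        = λ { refl i⟶⁺i → acyclic _ i⟶⁺i }
        ; trans         = Plus._++_
        ; <-resp-≈      = (λ { refl p → p }) , (λ { refl p → p })
        })

  -- Variables occurring in the subcircuit rooted at a node.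
  vars : Fin size → Pred (Fin m) 0ℓ
  vars i v = ∃ λ j → Star _⟶_ i j × (node j ≡ lit (pos v) ⊎ node j ≡ lit (neg v))

  module Fold {B : Set a} (top bot : B) (literal : Literal m → B)
              (disj conj : List B → B) where

    foldNode : (x : Node m size) → (∀ {j} → j ∈ children x → B) → B
    foldNode ⊤ₙ      rec = top
    foldNode ⊥ₙ      rec = bot
    foldNode (lit l) rec = literal l
    foldNode (⋁ₙ cs) rec = disj (mapWith∈ (toList cs) rec)
    foldNode (⋀ₙ cs) rec = conj (mapWith∈ (toList cs) rec)

    foldAcc : ∀ i → Acc (flip _⟶_) i → B
    foldAcc i (acc rs) = foldNode (node i) (λ {j} i⟶j → foldAcc j (rs i⟶j))

    fold : Fin size → B
    fold i = foldAcc i (children-wellFounded i)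

  formula : Fin size → Formula m
  formula = Fold.fold ⊤′ ⊥′ literalFormula (foldr _∨′_ ⊥′) (foldr _∧′_ ⊤′)

  Decomposable : Set
  Decomposable = ∀ i cs → node i ≡ ⋀ₙ cs →
    AllPairs (λ j k → ¬ (vars j ≬ vars k)) (toList cs)

  Smooth : Set
  Smooth = ∀ i cs → node i ≡ ⋁ₙ cs →
    ∀ {j k} → j ∈ toList cs → k ∈ toList cs → vars j ≐ vars k

Eval : {A : Set a} (N : NNF m) (_⊕_ _⊗_ : Op₂ A) (e⊕ e⊗ : A) →
       (Literal m → A) → A
Eval N _⊕_ _⊗_ e⊕ e⊗ α =
  Fold.fold e⊗ e⊕ α (foldr _⊕_ e⊕) (foldr _⊗_ e⊗) root
  where open NNF N

record IsSDNNFOf (T : Theory m) (N : NNF m) : Set where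
  open NNF N
  field
    smooth       : Smooth
    decomposable : Decomposable
    equivalent   : ∀ I → I ⊨ T ⇔ ⟦ formula root ⟧ I ≡ true
    allVars      : Universal (vars root)

{-# OPTIONS --safe #-}
module Submission where

-- Multiplying out the circuit turns it into a formal sum of terms, a term being
-- a list of literals: a literal l gives the single term l, ⊤ the empty term, ⊥
-- no term, a disjunction the terms of all its children, and a conjunction all
-- concatenations of one term per child.  Three facts about this expansion,
-- each proved by induction along the edges of the circuit, give the theorem.
--
--  * `value-terms`: by distributivity, the value of a node is the sum over its
--    terms of the products of their labels.  No circuit property is needed.
--  * `formula-terms`: an interpretation satisfies the formula of a node iff it
--    makes every literal of some term of the node true.  Again, no circuit
--    property is needed.
--  * `exact-terms`: in a smooth decomposable circuit, each term of a node
--    mentions every variable of that node exactly once, and no other variable.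
--    Decomposability rules out repetitions in a conjunction, and smoothness
--    makes the terms of the children of a disjunction mention the same
--    variables.
--
-- At the root all variables occur, so a term that an interpretation I makes
-- true is a permutation of the literals of I (`exact⇒literals`), and every term
-- is made true by some I (`exact⇒satisfiable`).  Hence the terms of the root
-- are, up to permutation, the models of T.  One model may arise from several
-- terms, since determinism is not assumed.  Idempotence makes a sum depend only
-- on the set of its summands (`Σ-≈`), so these repetitions do not matter.

open import Defs
open import Algebra.Bundles using (CommutativeSemiring)
open import Algebra.Definitions using (Idempotent)
open import Data.Bool.Base using (Bool; true; false; not)
import Data.Bool.Properties as Bool
open import Data.Fin.Base using (Fin)
open import Data.List.Base
  using (List; []; _∷_; _++_; map; foldr; concat; cartesianProductWith; tabulate)
open import Data.List.Membership.Propositional using (_∈_; find; lose)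
open import Data.List.Membership.Propositional.Properties
  using ( mapWith∈-cong; mapWith∈≗map; ∈-map⁺; ∈-map⁻; ∈-++⁺ˡ; ∈-++⁺ʳ; ∈-++⁻
        ; ∈-filter⁺; ∈-filter⁻; ∈-cartesianProductWith⁺; ∈-cartesianProductWith⁻
        ; ∈-tabulate⁺; ∈-tabulate⁻)
open import Data.List.Membership.Propositional.Properties.WithK
  using (unique∧set⇒bag)
open import Data.List.NonEmpty.Base using (toList)
open import Data.List.Properties using (map-++)
open import Data.List.Relation.Binary.BagAndSetEquality using (∼bag⇒↭)
open import Data.List.Relation.Binary.Permutation.Propositional
  using (_↭_; ↭⇒↭ₛ′)
open import Data.List.Relation.Binary.Permutation.Propositional.Properties
  using () renaming (map⁺ to ↭-map⁺)
import Data.List.Relation.Binary.Permutation.Setoid.Properties as ↭ₛ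
open import Data.List.Relation.Unary.All as All using (All; []; _∷_)
import Data.List.Relation.Unary.All.Properties as All
open import Data.List.Relation.Unary.AllPairs using (AllPairs; []; _∷_)
open import Data.List.Relation.Unary.Any as Any using (Any; here; there)
import Data.List.Relation.Unary.Any.Properties as Any
open import Data.List.Relation.Unary.Unique.Propositional using (Unique)
import Data.List.Relation.Unary.Unique.Propositional.Properties as Unique
open import Data.Nat.Base using (ℕ; zero; suc)
open import Data.Product.Base using (∃; _×_; _,_; proj₁; proj₂)
open import Data.Sum.Base using (_⊎_; inj₁; inj₂; [_,_])
open import Data.Unit.Base using (tt)
import Data.Vec.Base as Vec
open import Data.Vec.Base using (lookup)
open import Data.Vec.Properties using (lookup∘tabulate)
open import Function.Base using (_∘_; flip; id)
open import Function.Bundles using (_⇔_; mk⇔; module Equivalence)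
import Function.Properties.Equivalence as ⇔
open import Induction.WellFounded as WF using (Acc; acc)
open import Level using (Level)
open import Relation.Binary.Construct.Closure.ReflexiveTransitive using (ε; _◅_)
open import Relation.Binary.PropositionalEquality
  using (_≡_; refl; sym; trans; cong; subst)
open import Relation.Nullary.Negation using (¬_; contradiction)
open import Relation.Unary using (Pred; U; _≬_)

open Equivalence using (to; from)

private
  variable
    a b p q : Level
    A B     : Set a
    m       : ℕ

-- Lists

All-cong⇔ : {P : Pred A p} {Q : Pred A q} {xs : List A} →
            All (λ x → P x ⇔ Q x) xs → All P xs ⇔ All Q xs
All-cong⇔ es = mk⇔ (λ ps → All.zipWith (λ (e , x) → to e x) (es , ps))
                   (λ qs → All.zipWith (λ (e , x) → from e x) (es , qs))

Any-cong⇔ : {P : Pred A p} {Q : Pred A q} {xs : List A} →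
            All (λ x → P x ⇔ Q x) xs → Any P xs ⇔ Any Q xs
Any-cong⇔ es = mk⇔
  (λ ps → let _ , x∈xs , px = find ps in lose x∈xs (to (All.lookup es x∈xs) px))
  (λ qs → let _ , x∈xs , qx = find qs in lose x∈xs (from (All.lookup es x∈xs) qx))

unique-map⇒injective : (f : A → B) {xs : List A} → Unique (map f xs) →
                       ∀ {x y} → x ∈ xs → y ∈ xs → f x ≡ f y → x ≡ y
unique-map⇒injective f (_ ∷ _) (here refl) (here refl) _ = refl
unique-map⇒injective f (fx∉ ∷ _) (here refl) (there y∈) eq =
  contradiction eq (All.lookup fx∉ (∈-map⁺ f y∈))
unique-map⇒injective f (fx∉ ∷ _) (there x∈) (here refl) eq =
  contradiction (sym eq) (All.lookup fx∉ (∈-map⁺ f x∈))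
unique-map⇒injective f (_ ∷ uniq) (there x∈) (there y∈) eq =
  unique-map⇒injective f uniq x∈ y∈ eq

-- All concatenations of one list from each of the given collections, in order.
products : List (List (List A)) → List (List A)
products = foldr (cartesianProductWith _++_) ([] ∷ [])

Any-All-products : {P : Pred A p} (xsss : List (List (List A))) →
                   Any (All P) (products xsss) ⇔ All (Any (All P)) xsss
Any-All-products []           = mk⇔ (λ _ → []) (λ _ → here [])
Any-All-products (xss ∷ xsss) = mk⇔
  (λ h → let p , q = Any.cartesianProductWith⁻ _++_ (All.++⁻ _) xss _ h
         in p ∷ to (Any-All-products xsss) q)
  (λ { (p ∷ ps) → Any.cartesianProductWith⁺ _++_ All.++⁺ p
                    (from (Any-All-products xsss) ps) })

-- Literals and interpretations

-- A literal amounts to its variable together with its sign.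
variableOf : Literal m → Fin m
variableOf (pos v) = v
variableOf (neg v) = v

sign : Literal m → Bool
sign (pos _) = true
sign (neg _) = false

literalOf-variable-sign : (l : Literal m) → literalOf (variableOf l) (sign l) ≡ l
literalOf-variable-sign (pos _) = refl
literalOf-variable-sign (neg _) = refl

variableOf-literalOf : (v : Fin m) (s : Bool) → variableOf (literalOf v s) ≡ v
variableOf-literalOf v true  = refl
variableOf-literalOf v false = refl

-- The literal l is true under I.
Holds : Interpretation m → Literal m → Set
Holds I l = ⟦ literalFormula l ⟧ I ≡ true

holds⇔sign : (I : Interpretation m) (l : Literal m) →
             Holds I l ⇔ lookup I (variableOf l) ≡ sign l
holds⇔sign I (pos v) = ⇔.refl
holds⇔sign I (neg v) = mk⇔ Bool.not-injective (cong not)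

holds⇒literalOf : (I : Interpretation m) (l : Literal m) → Holds I l →
                  l ≡ literalOf (variableOf l) (lookup I (variableOf l))
holds⇒literalOf I l h =
  trans (sym (literalOf-variable-sign l))
        (cong (literalOf _) (sym (to (holds⇔sign I l) h)))

toList-tabulate : ∀ {n} (f : Fin n → A) →
                  Vec.toList (Vec.tabulate f) ≡ tabulate f
toList-tabulate {n = zero}  f = refl
toList-tabulate {n = suc n} f = cong (f _ ∷_) (toList-tabulate _)

∈-literals : (I : Interpretation m) {l : Literal m} →
             l ∈ literals I ⇔ (∃ λ v → l ≡ literalOf v (lookup I v))
∈-literals I rewrite toList-tabulate (λ v → literalOf v (lookup I v)) =
  mk⇔ ∈-tabulate⁻ (λ { (v , refl) → ∈-tabulate⁺ v })

literals-unique : (I : Interpretation m) → Unique (literals I)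
literals-unique I rewrite toList-tabulate (λ v → literalOf v (lookup I v)) =
  Unique.tabulate⁺ λ {v} {w} eq →
    trans (sym (variableOf-literalOf v (lookup I v)))
          (trans (cong variableOf eq) (variableOf-literalOf w (lookup I w)))

∈-interpretations : (I : Interpretation m) → I ∈ interpretations m
∈-interpretations Vec.[]      = here refl
∈-interpretations (s Vec.∷ I) =
  ∈-cartesianProductWith⁺ Vec._∷_ (sign∈ s) (∈-interpretations I)
  where
  sign∈ : ∀ s → s ∈ true ∷ false ∷ []
  sign∈ true  = here refl
  sign∈ false = there (here refl)

∈-models : (T : Theory m) {I : Interpretation m} → I ∈ models T ⇔ I ⊨ T
∈-models {m} T {I} = mk⇔
  (proj₂ ∘ ∈-filter⁻ (_⊨? T) {xs = interpretations m})
  (∈-filter⁺ (_⊨? T) (∈-interpretations I))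

⟦⋁⟧ : (φs : List (Formula m)) {I : Interpretation m} →
      ⟦ foldr _∨′_ ⊥′ φs ⟧ I ≡ true ⇔ Any (λ φ → ⟦ φ ⟧ I ≡ true) φs
⟦⋁⟧ φs = mk⇔ (⇒ φs) ⇐
  where
  ⇒ : ∀ φs {I} → ⟦ foldr _∨′_ ⊥′ φs ⟧ I ≡ true → Any (λ φ → ⟦ φ ⟧ I ≡ true) φs
  ⇒ (φ ∷ φs) {I} eq with ⟦ φ ⟧ I in φ-eq
  ... | true  = here φ-eq
  ... | false = there (⇒ φs eq)

  ⇐ : ∀ {φs I} → Any (λ φ → ⟦ φ ⟧ I ≡ true) φs → ⟦ foldr _∨′_ ⊥′ φs ⟧ I ≡ true
  ⇐ (here φ-eq) rewrite φ-eq = refl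
  ⇐ (there p)   rewrite ⇐ p    = Bool.∨-zeroʳ _

⟦⋀⟧ : (φs : List (Formula m)) {I : Interpretation m} →
      ⟦ foldr _∧′_ ⊤′ φs ⟧ I ≡ true ⇔ All (λ φ → ⟦ φ ⟧ I ≡ true) φs
⟦⋀⟧ φs = mk⇔ (⇒ φs) ⇐
  where
  ⇒ : ∀ φs {I} → ⟦ foldr _∧′_ ⊤′ φs ⟧ I ≡ true → All (λ φ → ⟦ φ ⟧ I ≡ true) φs
  ⇒ []       _  = []
  ⇒ (φ ∷ φs) eq = Bool.∧-conicalˡ _ _ eq ∷ ⇒ φs (Bool.∧-conicalʳ _ _ eq)

  ⇐ : ∀ {φs I} → All (λ φ → ⟦ φ ⟧ I ≡ true) φs → ⟦ foldr _∧′_ ⊤′ φs ⟧ I ≡ true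
  ⇐ []          = refl
  ⇐ (φ-eq ∷ ps) rewrite φ-eq = ⇐ ps

-- Terms and the variables they mention

-- A term stands for the conjunction, or the product of the labels, of its
-- literals.
Term : ℕ → Set
Term m = List (Literal m)

-- The variables of a term in order, repetitions kept.
mentioned : Term m → List (Fin m)
mentioned = map variableOf

-- The term mentions each variable in V exactly once, and no other variable.
Exact : Pred (Fin m) p → Pred (Term m) p
Exact V t = Unique (mentioned t) × (∀ {v} → v ∈ mentioned t ⇔ V v)

exact-resp-⇔ : {V : Pred (Fin m) p} {W : Pred (Fin m) q} →
               (∀ {v} → V v ⇔ W v) → ∀ {t} → Exact V t → Exact W t
exact-resp-⇔ V⇔W (uniq , supp) = uniq , ⇔.trans supp V⇔W

exact-++ : {V : Pred (Fin m) p} {W : Pred (Fin m) q} → ¬ (V ≬ W) →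
           ∀ {t u} → Exact V t → Exact W u → Exact (λ v → V v ⊎ W v) (t ++ u)
exact-++ disj {t} {u} (uniq-t , supp-t) (uniq-u , supp-u)
  rewrite map-++ variableOf t u =
    Unique.++⁺ uniq-t uniq-u
      (λ (v∈t , v∈u) → disj (_ , to supp-t v∈t , to supp-u v∈u))
  , mk⇔ ([ inj₁ ∘ to supp-t , inj₂ ∘ to supp-u ] ∘ ∈-++⁻ (mentioned t))
        [ ∈-++⁺ˡ ∘ from supp-t , ∈-++⁺ʳ (mentioned t) ∘ from supp-u ]

exact-products : (V : A → Pred (Fin m) p) (terms : A → List (Term m))
                 {xs : List A} →
                 AllPairs (λ x y → ¬ (V x ≬ V y)) xs →
                 All (λ x → All (Exact (V x)) (terms x)) xs →
                 All (Exact (λ v → Any (λ x → V x v) xs)) (products (map terms xs))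
exact-products V terms [] [] = ([] , mk⇔ (λ ()) (λ ())) ∷ []
exact-products V terms {x ∷ xs} (disj ∷ disjs) (ex ∷ exs) =
  All.tabulate λ t∈ →
    let t , u , t∈x , u∈xs , eq = ∈-cartesianProductWith⁻ _++_ (terms x) _ t∈
        exact-u = All.lookup (exact-products V terms disjs exs) u∈xs
    in subst (Exact _) (sym eq)
         (exact-resp-⇔ (mk⇔ Any.fromSum Any.toSum)
           (exact-++ head-disjoint (All.lookup ex t∈x) exact-u))
  where
  head-disjoint : ¬ (V x ≬ (λ v → Any (λ y → V y v) xs))
  head-disjoint (v , vx , vxs) =
    let _ , y∈xs , vy = find vxs in All.lookup disj y∈xs (v , vx , vy)

exact⇒literals : {t : Term m} → Exact U t →
                 (I : Interpretation m) → All (Holds I) t → t ↭ literals I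
exact⇒literals {t = t} (uniq , supp) I hs =
  ∼bag⇒↭ (unique∧set⇒bag (Unique.map⁻ uniq) (literals-unique I) (mk⇔ ⇒ ⇐))
  where
  ⇒ : ∀ {l} → l ∈ t → l ∈ literals I
  ⇒ {l} l∈t =
    from (∈-literals I) (variableOf l , holds⇒literalOf I l (All.lookup hs l∈t))

  ⇐ : ∀ {l} → l ∈ literals I → l ∈ t
  ⇐ l∈I with v , refl ← to (∈-literals I) l∈I
        with l′ , l′∈t , refl ← ∈-map⁻ variableOf (from (supp {v}) tt) =
    subst (_∈ t) (holds⇒literalOf I l′ (All.lookup hs l′∈t)) l′∈t

-- Each variable takes the sign of the literal of t in which it occurs.
exact⇒satisfiable : {t : Term m} → Exact U t → ∃ λ I → All (Holds I) t
exact⇒satisfiable {m} {t} (uniq , supp) = I , All.tabulate holds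
  where
  occurrence : ∀ v → ∃ λ l → l ∈ t × v ≡ variableOf l
  occurrence v = ∈-map⁻ variableOf (from supp tt)

  I : Interpretation m
  I = Vec.tabulate (sign ∘ proj₁ ∘ occurrence)

  holds : ∀ {l} → l ∈ t → Holds I l
  holds {l} l∈t = from (holds⇔sign I l)
    (let _ , l′∈t , eq = occurrence (variableOf l)
     in trans (lookup∘tabulate (sign ∘ proj₁ ∘ occurrence) (variableOf l))
          (cong sign (unique-map⇒injective variableOf uniq l′∈t l∈t (sym eq))))

-- Circuits

module Circuit {m} (N : NNF m) where
  open NNF N

  -- Induction along the edges, with the label of the node made explicit.
  node-induction : (P : Pred (Fin size) p) →
                   (∀ i x → node i ≡ x → All P (children x) → P i) → ∀ i → P i
  node-induction {p} P step = wfRec P λ i ih → step i (node i) refl (All.tabulate ih)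
    where open WF.All children-wellFounded p using (wfRec)

  module FoldProperties {B : Set b} (top bot : B) (literal : Literal m → B)
                        (disj conj : List B → B) where
    open Fold top bot literal disj conj

    foldNode-cong : ∀ x {f g : ∀ {j} → j ∈ children x → B} →
                    (∀ {j} (j∈ : j ∈ children x) → f j∈ ≡ g j∈) →
                    foldNode x f ≡ foldNode x g
    foldNode-cong ⊤ₙ      eq = refl
    foldNode-cong ⊥ₙ      eq = refl
    foldNode-cong (lit l) eq = refl
    foldNode-cong (⋁ₙ cs) eq = cong disj (mapWith∈-cong (toList cs) _ _ eq)
    foldNode-cong (⋀ₙ cs) eq = cong conj (mapWith∈-cong (toList cs) _ _ eq)

    foldAcc-irrelevant : ∀ i (r s : Acc (flip _⟶_) i) → foldAcc i r ≡ foldAcc i s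
    foldAcc-irrelevant i (acc rs) (acc ss) = foldNode-cong (node i)
      λ i⟶j → foldAcc-irrelevant _ (rs i⟶j) (ss i⟶j)

    -- One layer of the recursion: the value of a label whose edges lead to
    -- folded children.
    foldLabel : Node m size → B
    foldLabel ⊤ₙ      = top
    foldLabel ⊥ₙ      = bot
    foldLabel (lit l) = literal l
    foldLabel (⋁ₙ cs) = disj (map fold (toList cs))
    foldLabel (⋀ₙ cs) = conj (map fold (toList cs))

    foldNode-fold : ∀ x → foldNode x (λ {j} _ → fold j) ≡ foldLabel x
    foldNode-fold ⊤ₙ      = refl
    foldNode-fold ⊥ₙ      = refl
    foldNode-fold (lit l) = refl
    foldNode-fold (⋁ₙ cs) = cong disj (mapWith∈≗map fold (toList cs))
    foldNode-fold (⋀ₙ cs) = cong conj (mapWith∈≗map fold (toList cs))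

    -- The recursion equation of `fold`, free of accessibility proofs.
    fold-node : ∀ {i x} → node i ≡ x → fold i ≡ foldLabel x
    fold-node {i} refl =
      trans (unfold (children-wellFounded i)) (foldNode-fold (node i))
      where
      unfold : ∀ r → foldAcc i r ≡ foldNode (node i) (λ {j} _ → fold j)
      unfold (acc rs) = foldNode-cong (node i) λ i⟶j →
        foldAcc-irrelevant _ (rs i⟶j) (children-wellFounded _)

  vars-node : ∀ {i x v} → node i ≡ x →
              vars i v ⇔ ((x ≡ lit (pos v) ⊎ x ≡ lit (neg v)) ⊎
                          Any (λ j → vars j v) (children x))
  vars-node {i} {v = v} refl = mk⇔ ⇒ [ (λ e → i , ε , e) , ⇐ ]
    where
    ⇒ : vars i v → _
    ⇒ (_ , ε            , e) = inj₁ e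
    ⇒ (k , i⟶j ◅ j⟶*k , e) = inj₂ (lose i⟶j (k , j⟶*k , e))

    ⇐ : Any (λ j → vars j v) (children (node i)) → vars i v
    ⇐ h = let _ , i⟶j , k , j⟶*k , e = find h in k , i⟶j ◅ j⟶*k , e

  -- The terms of a node: the monomials obtained by multiplying out the
  -- subcircuit rooted at it, with repetitions.
  terms : Fin size → List (Term m)
  terms = Fold.fold ([] ∷ []) [] (λ l → (l ∷ []) ∷ []) concat products

  open FoldProperties ([] ∷ []) [] (λ l → (l ∷ []) ∷ []) concat products
    public using () renaming (fold-node to terms-node)
  open FoldProperties ⊤′ ⊥′ literalFormula (foldr _∨′_ ⊥′) (foldr _∧′_ ⊤′)
    using () renaming (fold-node to formula-node)

  formula-terms : (I : Interpretation m) →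
                  ∀ i → ⟦ formula i ⟧ I ≡ true ⇔ Any (All (Holds I)) (terms i)
  formula-terms I = node-induction _ step
    where
    step : ∀ i x → node i ≡ x →
           All (λ j → ⟦ formula j ⟧ I ≡ true ⇔ Any (All (Holds I)) (terms j))
               (children x) →
           ⟦ formula i ⟧ I ≡ true ⇔ Any (All (Holds I)) (terms i)
    step i x eq ih rewrite formula-node eq | terms-node eq with x
    ... | ⊤ₙ    = mk⇔ (λ _ → here []) (λ _ → refl)
    ... | ⊥ₙ    = mk⇔ (λ ()) (λ ())
    ... | lit l = mk⇔ (λ h → here (h ∷ [])) (λ { (here (h ∷ [])) → h })
    ... | ⋁ₙ cs =
      ⇔.trans (⟦⋁⟧ (map formula (toList cs)))
      (⇔.trans (mk⇔ Any.map⁻ Any.map⁺)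
      (⇔.trans (Any-cong⇔ ih)
      (⇔.trans (mk⇔ Any.map⁺ Any.map⁻)
               (mk⇔ Any.concat⁺ (Any.concat⁻ _)))))
    ... | ⋀ₙ cs =
      ⇔.trans (⟦⋀⟧ (map formula (toList cs)))
      (⇔.trans (mk⇔ All.map⁻ All.map⁺)
      (⇔.trans (All-cong⇔ ih)
      (⇔.trans (mk⇔ All.map⁺ All.map⁻)
               (⇔.sym (Any-All-products (map terms (toList cs)))))))

  exact-terms : Smooth → Decomposable → ∀ i → All (Exact (vars i)) (terms i)
  exact-terms smooth decomposable = node-induction _ step
    where
    step : ∀ i x → node i ≡ x →
           All (λ j → All (Exact (vars j)) (terms j)) (children x) →
           All (Exact (vars i)) (terms i)
    step i ⊤ₙ eq ih rewrite terms-node eq =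
      exact-resp-⇔ (⇔.sym (vars-node eq))
        ([] , mk⇔ (λ ()) (λ { (inj₁ (inj₁ ())) ; (inj₁ (inj₂ ())) ; (inj₂ ()) })) ∷ []
    step i ⊥ₙ eq ih rewrite terms-node eq = []
    step i (lit l) eq ih rewrite terms-node eq =
      exact-resp-⇔ (⇔.sym (vars-node eq)) {l ∷ []} ([] ∷ [] , mk⇔ (⇒ l) ⇐) ∷ []
      where
      ⇒ : ∀ l {v} → v ∈ variableOf l ∷ [] →
          (lit l ≡ lit (pos v) ⊎ lit l ≡ lit (neg v)) ⊎ Any (λ j → vars j v) []
      ⇒ (pos _) (here refl) = inj₁ (inj₁ refl)
      ⇒ (neg _) (here refl) = inj₁ (inj₂ refl)

      ⇐ : ∀ {v} →
          (lit l ≡ lit (pos v) ⊎ lit l ≡ lit (neg v)) ⊎ Any (λ j → vars j v) [] →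
          v ∈ variableOf l ∷ []
      ⇐ (inj₁ (inj₁ refl)) = here refl
      ⇐ (inj₁ (inj₂ refl)) = here refl
    step i (⋁ₙ cs) eq ih rewrite terms-node eq =
      All.concat⁺ (All.map⁺ (All.tabulate λ j∈cs →
        All.map (exact-resp-⇔ (vars-child j∈cs)) (All.lookup ih j∈cs)))
      where
      -- By smoothness, a single child mentions all variables of the disjunction.
      vars-child : ∀ {j v} → j ∈ toList cs → vars j v ⇔ vars i v
      vars-child j∈cs = mk⇔
        (λ vj → from (vars-node eq) (inj₂ (lose j∈cs vj)))
        (λ vi → [ (λ { (inj₁ ()) ; (inj₂ ()) })
                , (λ h → let _ , k∈cs , vk = find h
                         in proj₁ (smooth i cs eq k∈cs j∈cs) vk)
                ] (to (vars-node eq) vi))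
    step i (⋀ₙ cs) eq ih rewrite terms-node eq =
      All.map (exact-resp-⇔ (mk⇔ (from (vars-node eq) ∘ inj₂)
                                 ([ (λ { (inj₁ ()) ; (inj₂ ()) }) , id ]
                                    ∘ to (vars-node eq))))
              (exact-products vars terms (decomposable i cs eq) ih)

-- Sums and products in a commutative semiring

module Sums {c ℓ} (𝒜 : CommutativeSemiring c ℓ) where
  open CommutativeSemiring 𝒜
    renaming (refl to ≈-refl; sym to ≈-sym; trans to ≈-trans; reflexive to ≈-reflexive)
  open import Relation.Binary.Reasoning.Setoid setoid

  -- The sum and the product of f over a list, counting repetitions.
  Σ : (A → Carrier) → List A → Carrier
  Σ f xs = foldr _+_ 0# (map f xs)

  Π : (A → Carrier) → List A → Carrier
  Π f xs = foldr _*_ 1# (map f xs)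

  Σ-++ : (f : A → Carrier) (xs ys : List A) → Σ f (xs ++ ys) ≈ Σ f xs + Σ f ys
  Σ-++ f []       ys = ≈-sym (+-identityˡ _)
  Σ-++ f (x ∷ xs) ys = ≈-trans (+-congˡ (Σ-++ f xs ys)) (≈-sym (+-assoc _ _ _))

  Π-++ : (f : A → Carrier) (xs ys : List A) → Π f (xs ++ ys) ≈ Π f xs * Π f ys
  Π-++ f []       ys = ≈-sym (*-identityˡ _)
  Π-++ f (x ∷ xs) ys = ≈-trans (*-congˡ (Π-++ f xs ys)) (≈-sym (*-assoc _ _ _))

  Π-↭ : (f : A → Carrier) {xs ys : List A} → xs ↭ ys → Π f xs ≈ Π f ys
  Π-↭ f xs↭ys = ↭ₛ.foldr-commMonoid setoid *-isCommutativeMonoid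
    (↭⇒↭ₛ′ isEquivalence (↭-map⁺ f xs↭ys))

  ΣΠ-map-++ : (f : A → Carrier) (xs : List A) (yss : List (List A)) →
              Σ (Π f) (map (xs ++_) yss) ≈ Π f xs * Σ (Π f) yss
  ΣΠ-map-++ f xs []         = ≈-sym (zeroʳ _)
  ΣΠ-map-++ f xs (ys ∷ yss) = begin
    Π f (xs ++ ys) + Σ (Π f) (map (xs ++_) yss)
      ≈⟨ +-cong (Π-++ f xs ys) (ΣΠ-map-++ f xs yss) ⟩
    Π f xs * Π f ys + Π f xs * Σ (Π f) yss
      ≈⟨ distribˡ _ _ _ ⟨
    Π f xs * (Π f ys + Σ (Π f) yss) ∎

  ΣΠ-cartesianProduct : (f : A → Carrier) (xss yss : List (List A)) →
    Σ (Π f) (cartesianProductWith _++_ xss yss) ≈ Σ (Π f) xss * Σ (Π f) yss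
  ΣΠ-cartesianProduct f []         yss = ≈-sym (zeroˡ _)
  ΣΠ-cartesianProduct f (xs ∷ xss) yss = begin
    Σ (Π f) (map (xs ++_) yss ++ cartesianProductWith _++_ xss yss)
      ≈⟨ Σ-++ (Π f) (map (xs ++_) yss) _ ⟩
    Σ (Π f) (map (xs ++_) yss) + Σ (Π f) (cartesianProductWith _++_ xss yss)
      ≈⟨ +-cong (ΣΠ-map-++ f xs yss) (ΣΠ-cartesianProduct f xss yss) ⟩
    Π f xs * Σ (Π f) yss + Σ (Π f) xss * Σ (Π f) yss
      ≈⟨ distribʳ _ _ _ ⟨
    (Π f xs + Σ (Π f) xss) * Σ (Π f) yss ∎

  Σ-concat : (f : B → Carrier) (g : A → Carrier) (h : A → List B) {xs : List A} →
             All (λ x → g x ≈ Σ f (h x)) xs → Σ g xs ≈ Σ f (concat (map h xs))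
  Σ-concat f g h []                 = ≈-refl
  Σ-concat f g h {x ∷ xs} (eq ∷ eqs) =
    ≈-trans (+-cong eq (Σ-concat f g h eqs)) (≈-sym (Σ-++ f (h x) _))

  Π-products : (f : B → Carrier) (g : A → Carrier) (h : A → List (List B))
               {xs : List A} → All (λ x → g x ≈ Σ (Π f) (h x)) xs →
               Π g xs ≈ Σ (Π f) (products (map h xs))
  Π-products f g h []                 = ≈-sym (+-identityʳ _)
  Π-products f g h {x ∷ xs} (eq ∷ eqs) =
    ≈-trans (*-cong eq (Π-products f g h eqs))
            (≈-sym (ΣΠ-cartesianProduct f (h x) _))

  module _ {m} (N : NNF m) (α : Literal m → Carrier) where
    open NNF N
    open Circuit N

    -- The value of every node; at the root it is Eval.
    value : Fin size → Carrier
    value = Fold.fold 1# 0# α (foldr _+_ 0#) (foldr _*_ 1#)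

    open FoldProperties 1# 0# α (foldr _+_ 0#) (foldr _*_ 1#)
      using () renaming (fold-node to value-node)

    value-terms : ∀ i → value i ≈ Σ (Π α) (terms i)
    value-terms = node-induction _ step
      where
      step : ∀ i x → node i ≡ x → All (λ j → value j ≈ Σ (Π α) (terms j)) (children x) →
             value i ≈ Σ (Π α) (terms i)
      step i x eq ih rewrite value-node eq | terms-node eq with x
      ... | ⊤ₙ    = ≈-sym (+-identityʳ _)
      ... | ⊥ₙ    = ≈-refl
      ... | lit l = ≈-sym (≈-trans (+-identityʳ _) (*-identityʳ _))
      ... | ⋁ₙ cs = Σ-concat (Π α) value terms ih
      ... | ⋀ₙ cs = Π-products α value terms ih

  module _ (+-idem : Idempotent _≈_ _+_) where

    summand-absorbed : (f : A → Carrier) {x : A} {xs : List A} → x ∈ xs →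
                       f x + Σ f xs ≈ Σ f xs
    summand-absorbed f {x} (here {xs = xs} refl) = begin
      f x + (f x + Σ f xs) ≈⟨ +-assoc _ _ _ ⟨
      f x + f x + Σ f xs   ≈⟨ +-congʳ (+-idem _) ⟩
      f x + Σ f xs         ∎
    summand-absorbed f {x} (there {x = y} {xs = xs} x∈xs) = begin
      f x + (f y + Σ f xs) ≈⟨ +-assoc _ _ _ ⟨
      f x + f y + Σ f xs   ≈⟨ +-congʳ (+-comm _ _) ⟩
      f y + f x + Σ f xs   ≈⟨ +-assoc _ _ _ ⟩
      f y + (f x + Σ f xs) ≈⟨ +-congˡ (summand-absorbed f x∈xs) ⟩
      f y + Σ f xs         ∎

    Σ-absorbed : (f : A → Carrier) (g : B → Carrier) (xs : List A) (ys : List B) →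
                 (∀ {x} → x ∈ xs → ∃ λ y → y ∈ ys × f x ≈ g y) →
                 Σ f xs + Σ g ys ≈ Σ g ys
    Σ-absorbed f g []       ys h = +-identityˡ _
    Σ-absorbed f g (x ∷ xs) ys h = let y , y∈ys , fx≈gy = h (here refl) in begin
      f x + Σ f xs + Σ g ys   ≈⟨ +-assoc _ _ _ ⟩
      f x + (Σ f xs + Σ g ys) ≈⟨ +-cong fx≈gy (Σ-absorbed f g xs ys (h ∘ there)) ⟩
      g y + Σ g ys            ≈⟨ summand-absorbed g y∈ys ⟩
      Σ g ys                  ∎

    -- In the order x ≤ y iff x + y ≈ y, this is antisymmetry.
    Σ-≈ : (f : A → Carrier) (g : B → Carrier) (xs : List A) (ys : List B) →
          (∀ {x} → x ∈ xs → ∃ λ y → y ∈ ys × f x ≈ g y) →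
          (∀ {y} → y ∈ ys → ∃ λ x → x ∈ xs × g y ≈ f x) →
          Σ f xs ≈ Σ g ys
    Σ-≈ f g xs ys f⊆g g⊆f = begin
      Σ f xs          ≈⟨ Σ-absorbed g f ys xs g⊆f ⟨
      Σ g ys + Σ f xs ≈⟨ +-comm _ _ ⟩
      Σ f xs + Σ g ys ≈⟨ Σ-absorbed f g xs ys f⊆g ⟩
      Σ g ys          ∎

theorem3 : ∀ {c ℓ} (m : ℕ) (T : Theory m) (𝒜 : CommutativeSemiring c ℓ) →
    let open CommutativeSemiring 𝒜 in
    Idempotent _≈_ _+_ →
    (α : Literal m → Carrier) (N : NNF m) →
    IsSDNNFOf T N →
    Eval N _+_ _*_ 0# 1# α ≈ AMC _+_ _*_ 0# 1# α T
theorem3 m T 𝒜 +-idem α N isSDNNF =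
  𝒜.trans (value-terms N α root)
    (Σ-≈ +-idem (Π α) (Π α ∘ literals) (terms root) (models T) term⇒model model⇒term)
  where
  module 𝒜 = CommutativeSemiring 𝒜
  open Sums 𝒜
  open NNF N
  open Circuit N
  open IsSDNNFOf isSDNNF

  exact : ∀ {t} → t ∈ terms root → Exact U t
  exact t∈ = exact-resp-⇔ (mk⇔ (λ _ → tt) (λ _ → allVars _))
               (All.lookup (exact-terms smooth decomposable root) t∈)

  term⇒model : ∀ {t} → t ∈ terms root →
               ∃ λ I → I ∈ models T × Π α t 𝒜.≈ Π α (literals I)
  term⇒model t∈ =
    let I , holds = exact⇒satisfiable (exact t∈)
        I⊨T = from (equivalent I) (from (formula-terms I root) (lose t∈ holds))
    in I , from (∈-models T) I⊨T , Π-↭ α (exact⇒literals (exact t∈) I holds)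

  model⇒term : ∀ {I} → I ∈ models T →
               ∃ λ t → t ∈ terms root × Π α (literals I) 𝒜.≈ Π α t
  model⇒term {I} I∈ =
    let I⊨root = to (equivalent I) (to (∈-models T) I∈)
        t , t∈ , holds = find (to (formula-terms I root) I⊨root)
    in t , t∈ , 𝒜.sym (Π-↭ α (exact⇒literals (exact t∈) I holds))
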